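{- Let $\beta_\bullet\in\{\beta,\beta_v\}$, let $\to_{\beta_\bullet}$ be the contextual closure of the rule $\beta_\bullet$ on $\Lambda_{\mathcal O}$, and let $\rightsquigarrow_U$ be the unbiased iteration of an associated surface reduction (as defined in the context). Then $\rightsquigarrow_U$ is a normalizing strategy for $\to_{\beta_\bullet}$.
   Context: Terms: $M::=x\mid\lambda x.M\mid MM\mid \mathsf{op}(M,\dots,M)$, $\mathsf{op}$ ranging over a (possibly empty) set $\mathcal O$ of operator symbols with fixed arities, up to renaming of bound variables; this set is $\Lambda_{\mathcal O}$. Values $V::=x\mid\lambda x.M$. Contexts $C::=[\,]\mid MC\mid CM\mid\lambda x.C\mid\mathsf{op}(M,\dots,C,\dots,M)$. Rules $(\lambda x.M)N\mapsto_\beta M\{N/x\}$; $(\lambda x.M)V\mapsto_{\beta_v}M\{V/x\}$ ($V$ a value); $\to_{\beta_\bullet}$ is the closure under all contexts. Head contexts $H::=[\,]\mid\lambda x.H\mid HM$; weak $W::=[\,]\mid WM\mid MW$; left $L::=[\,]\mid LM\mid VL$; right $R::=[\,]\mid MR\mid RV$. Surface reduction $\to_s$: for $\beta$, closure of $\beta$ under head contexts; for $\beta_v$, closure of $\beta_v$ under weak, or left, or right contexts (any one choice). $\rightsquigarrow_U$ is defined inductively: if $M\to_sM'$ then $M\rightsquigarrow_UM'$; if $M$ is $\to_s$-normal: $\lambda x.P\rightsquigarrow_U\lambda x.P'$ if $P\rightsquigarrow_UP'$; $PQ\rightsquigarrow_UP'Q$ if $P\rightsquigarrow_UP'$; $PQ\rightsquigarrow_UPQ'$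 if $Q\rightsquigarrow_UQ'$; $\mathsf{op}(\dots,P_i,\dots)\rightsquigarrow_U\mathsf{op}(\dots,P_i',\dots)$ if $P_i\rightsquigarrow_UP_i'$. A relation $\rightsquigarrow\subseteq\to$ is a normalizing strategy for $\to$ if it has the same normal forms as $\to$ and, whenever $t$ has a $\to$-normal form (i.e. $t\to^*u$ with $u$ $\to$-normal), every maximal $\rightsquigarrow$-sequence from $t$ (infinite, or finite ending in a $\rightsquigarrow$-normal form) ends in a $\to$-normal form. -}

module Defs where

open import Data.Nat.Base using (ℕ; zero; suc)
open import Data.Fin.Base using (Fin)
open import Data.Fin.Substitution using (Lift; Sub; TermSubst)
open import Data.Vec.Base using (Vec; []; _∷_; lookup; _[_]≔_)
open import Function.Bundles using (_⇔_)
open import Level using (Level; _⊔_)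
open import Relation.Binary.Core using (Rel; _⇒_)
open import Relation.Binary.Construct.Closure.ReflexiveTransitive using (Star)
open import Relation.Binary.PropositionalEquality.Core using (_≡_)
open import Relation.Binary.Rewriting using (IsNormalForm; HasNormalForm)

private
  variable
    a ℓ ℓ₁ ℓ₂ p : Level

------------------------------------------------------------------------
-- Normalizing strategies

data MaximalSequence {A : Set a} (_⟶_ : Rel A ℓ) (t : A) : Set (a ⊔ ℓ) where
  finite   : ∀ {u} → Star _⟶_ t u → IsNormalForm _⟶_ u → MaximalSequence _⟶_ t
  infinite : (f : ℕ → A) → f 0 ≡ t → (∀ i → f i ⟶ f (suc i)) →
             MaximalSequence _⟶_ t

data EndsIn {A : Set a} {_⟶_ : Rel A ℓ} (P : A → Set p) {t : A} :
            MaximalSequence _⟶_ t → Set (a ⊔ ℓ ⊔ p) where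
  ends : ∀ {u} {r : Star _⟶_ t u} {nf : IsNormalForm _⟶_ u} →
         P u → EndsIn P (finite r nf)

record IsNormalizingStrategy {A : Set a} (_⟶_ : Rel A ℓ₁) (_⇝_ : Rel A ℓ₂) :
                             Set (a ⊔ ℓ₁ ⊔ ℓ₂) where
  field
    subrelation     : _⇝_ ⇒ _⟶_
    sameNormalForms : ∀ t → IsNormalForm _⇝_ t ⇔ IsNormalForm _⟶_ t
    normalizing     : ∀ t → HasNormalForm _⟶_ t →
                      (σ : MaximalSequence _⇝_ t) → EndsIn (IsNormalForm _⟶_) σ

------------------------------------------------------------------------
-- The calculi

record Signature : Set₁ where
  field
    Op    : Set
    arity : Op → ℕ

data Rule : Set where
  β βᵥ : Rule

-- The admissible choices of surface contexts for each rule.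
data Surface : Rule → Set where
  head            : Surface β
  weak left right : Surface βᵥ

module _ (𝒪 : Signature) where

  open Signature 𝒪

  infixl 9 _·_

  -- Term n is the set of terms, modulo α, whose free variables are among n
  -- fixed ones (de Bruijn indices).
  data Term (n : ℕ) : Set where
    var : Fin n → Term n
    ƛ   : Term (suc n) → Term n
    _·_ : Term n → Term n → Term n
    op  : (o : Op) → Vec (Term n) (arity o) → Term n

  module TermApp {ℓ} {T : ℕ → Set ℓ} (l : Lift T Term) where
    open Lift l hiding (var)

    infixl 8 _/_ _/*_

    mutual
      _/_ : ∀ {m n} → Term m → Sub T m n → Term n
      var x   / ρ = lift (lookup ρ x)
      ƛ M     / ρ = ƛ (M / ρ ↑)
      (M · N) / ρ = (M / ρ) · (N / ρ)
      op o Ms / ρ = op o (Ms /* ρ)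

      _/*_ : ∀ {m n k} → Vec (Term m) k → Sub T m n → Vec (Term n) k
      []       /* ρ = []
      (M ∷ Ms) /* ρ = (M / ρ) ∷ (Ms /* ρ)

  termSubst : TermSubst Term
  termSubst = record { var = var ; app = TermApp._/_ }

  open TermSubst termSubst using (_/_; sub)

  data Value {n : ℕ} : Term n → Set where
    var : ∀ x → Value (var x)
    ƛ   : ∀ M → Value (ƛ M)

  data _⊢_↦_ : Rule → ∀ {n} → Rel (Term n) Level.zero where
    contract  : ∀ {n} {M : Term (suc n)} {N} → β ⊢ ƛ M · N ↦ (M / sub N)
    contractᵥ : ∀ {n} {M : Term (suc n)} {V} → Value V →
                βᵥ ⊢ ƛ M · V ↦ (M / sub V)

  infixl 9 _·₁_ _·₂_

  -- Context k n: the hole takes a Term k (k = n plus the number of binders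
  -- above the hole, whose variables are captured); filling it gives a Term n.
  -- In op o i Ms C the hole lies in the i-th argument; the i-th entry of Ms is
  -- ignored, being overwritten by plug.
  data Context (k : ℕ) : ℕ → Set where
    □    : Context k k
    _·₁_ : ∀ {n} → Context k n → Term n → Context k n
    _·₂_ : ∀ {n} → Term n → Context k n → Context k n
    ƛ    : ∀ {n} → Context k (suc n) → Context k n
    op   : ∀ {n} (o : Op) (i : Fin (arity o)) → Vec (Term n) (arity o) →
           Context k n → Context k n

  plug : ∀ {k n} → Context k n → Term k → Term n
  plug □             P = P
  plug (C ·₁ M)      P = plug C P · M
  plug (M ·₂ C)      P = M · plug C P
  plug (ƛ C)         P = ƛ (plug C P)
  plug (op o i Ms C) P = op o (Ms [ i ]≔ plug C P)

  data IsHead {k : ℕ} : ∀ {n} → Context k n → Set where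
    □    : IsHead □
    ƛ    : ∀ {n} {H : Context k (suc n)} → IsHead H → IsHead (ƛ H)
    _·₁_ : ∀ {n} {H : Context k n} → IsHead H → ∀ M → IsHead (H ·₁ M)

  data IsWeak {k : ℕ} : ∀ {n} → Context k n → Set where
    □    : IsWeak □
    _·₁_ : ∀ {n} {W : Context k n} → IsWeak W → ∀ M → IsWeak (W ·₁ M)
    _·₂_ : ∀ {n} {W : Context k n} → ∀ M → IsWeak W → IsWeak (M ·₂ W)

  data IsLeft {k : ℕ} : ∀ {n} → Context k n → Set where
    □    : IsLeft □
    _·₁_ : ∀ {n} {L : Context k n} → IsLeft L → ∀ M → IsLeft (L ·₁ M)
    _·₂_ : ∀ {n} {V} {L : Context k n} → Value V → IsLeft L → IsLeft (V ·₂ L)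

  data IsRight {k : ℕ} : ∀ {n} → Context k n → Set where
    □    : IsRight □
    _·₂_ : ∀ {n} {R : Context k n} → ∀ M → IsRight R → IsRight (M ·₂ R)
    _·₁_ : ∀ {n} {V} {R : Context k n} → IsRight R → Value V → IsRight (R ·₁ V)

  IsSurface : ∀ {b k n} → Surface b → Context k n → Set
  IsSurface head  = IsHead
  IsSurface weak  = IsWeak
  IsSurface left  = IsLeft
  IsSurface right = IsRight

  data Reduction (b : Rule) {n : ℕ} : Rel (Term n) Level.zero where
    step : ∀ {k} (C : Context k n) {P Q : Term k} → b ⊢ P ↦ Q →
           Reduction b (plug C P) (plug C Q)

  data SurfaceReduction {b : Rule} (s : Surface b) {n : ℕ} :
                        Rel (Term n) Level.zero where
    step : ∀ {k} {C : Context k n} {P Q : Term k} → IsSurface s C → b ⊢ P ↦ Q →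
           SurfaceReduction s (plug C P) (plug C Q)

  data Unbiased {b : Rule} (s : Surface b) {n : ℕ} :
                Rel (Term n) Level.zero where
    surface : ∀ {M M′} → SurfaceReduction s M M′ → Unbiased s M M′
    ƛ       : ∀ {P P′} → IsNormalForm (SurfaceReduction s) (ƛ P) →
              Unbiased s P P′ → Unbiased s (ƛ P) (ƛ P′)
    appˡ    : ∀ {P P′ Q} → IsNormalForm (SurfaceReduction s) (P · Q) →
              Unbiased s P P′ → Unbiased s (P · Q) (P′ · Q)
    appʳ    : ∀ {P Q Q′} → IsNormalForm (SurfaceReduction s) (P · Q) →
              Unbiased s Q Q′ → Unbiased s (P · Q) (P · Q′)
    op      : ∀ {o Ps} i {P′} → IsNormalForm (SurfaceReduction s) (op o Ps) →
              Unbiased s (lookup Ps i) P′ →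
              Unbiased s (op o Ps) (op o (Ps [ i ]≔ P′))

-- Random descent applies to ⇝ because ⇝ has the diamond property: surface reduction has it, and
-- a step inside a surface-normal term keeps the term surface-normal, so steps in different
-- immediate subterms commute.  Hence all maximal ⇝-sequences from t have the same length as soon
-- as one of them ends.  One that ends is obtained by Kashima-style standardization: every
-- reduction M →* N can be reorganized into M →s* M′ with M′ of the same top-level shape as N and
-- its immediate subterms reducing, standardly, to those of N.  When N is normal, interleaving the
-- reductions of the subterms in the order prescribed by ⇝ gives M ⇝* N.

module Submission where

open import Defs
open import Data.Empty using (⊥; ⊥-elim)
open import Data.Fin.Base using (Fin; zero; suc)
open import Data.Fin.Properties using (_≟_)
open import Data.Fin.Substitution using (Application; Lift; Sub; Subs; TermSubst)
open import Data.Fin.Substitution.Lemmas using (TermLemmas)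
open import Data.Nat.Base using (ℕ; zero; suc; _+_)
open import Data.Product.Base using (∃; _×_; _,_; proj₁; proj₂)
open import Data.Sum.Base using (_⊎_; inj₁; inj₂)
open import Data.Unit.Base using (⊤; tt)
open import Data.Vec.Base using (Vec; []; _∷_; lookup; map; _[_]≔_)
open import Data.Vec.Properties
  using (lookup-map; map-id; lookup∘update; lookup∘update′;
         []≔-idempotent; []≔-commutes; []≔-lookup)
open import Function.Base using (_∘_)
open import Function.Bundles using (mk⇔)
open import Level using (Level; 0ℓ; _⊔_)
open import Relation.Binary.Core using (Rel)
open import Relation.Binary.Construct.Closure.ReflexiveTransitive as Star
  using (Star; ε; _◅_; _◅◅_; gmap)
open import Relation.Binary.PropositionalEquality
  using (_≡_; refl; sym; trans; cong; cong₂; subst; module ≡-Reasoning)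
open import Relation.Binary.Rewriting using (IsNormalForm; HasNormalForm)
open import Relation.Nullary.Decidable using (Dec; yes; no; map′; _×-dec_; _⊎-dec_)
open import Relation.Nullary.Negation using (¬_; contradiction)

private
  variable
    a ℓ ℓ₁ ℓ₂ : Level
    A B : Set a
    k m n : ℕ

-- Random descent

-- Exactly one step on each side, or none at all: a join with sides of different lengths would
-- destroy the invariance of length on which random descent rests.
data Join {A : Set a} (R : Rel A ℓ) (x : A) : A → Set (a ⊔ ℓ) where
  equal  : Join R x x
  joined : ∀ {y z} → R x z → R y z → Join R x y

-- Monotonicity is asked only for steps out of the two reducts: the inner rules of `Unbiased` need a
-- surface-normal source, and only `f x` and `f y` are known to be so.
Join-map : {R : Rel A ℓ₁} {S : Rel B ℓ₂} (f : A → B) {x y : A} →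
           (∀ {u v} → u ≡ x ⊎ u ≡ y → R u v → S (f u) (f v)) → Join R x y → Join S (f x) (f y)
Join-map f mono equal          = equal
Join-map f mono (joined xz yz) = joined (mono (inj₁ refl) xz) (mono (inj₂ refl) yz)

module RandomDescent {A : Set a} {_⟶_ : Rel A ℓ}
                     (diamond : ∀ {x y z} → x ⟶ y → x ⟶ z → Join _⟶_ y z) where

  data Normalizes : ℕ → A → Set (a ⊔ ℓ) where
    normal : ∀ {x} → IsNormalForm _⟶_ x → Normalizes zero x
    _◅_    : ∀ {k x y} → x ⟶ y → Normalizes k y → Normalizes (suc k) x

  fromStar : ∀ {x y} → Star _⟶_ x y → IsNormalForm _⟶_ y → ∃ λ k → Normalizes k x
  fromStar ε        nf = zero , normal nf
  fromStar (r ◅ rs) nf with fromStar rs nf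
  ... | k , d = suc k , r ◅ d

  -- Close the peak formed by the first step of the given sequence and the new step. If the sides
  -- differ, the joining step shortens the rest of the sequence by induction, and the opposite
  -- joining step restores the length.
  descend : ∀ {k x y} → Normalizes (suc k) x → x ⟶ y → Normalizes k y
  descend (p ◅ d) q with diamond p q
  descend (p ◅ d)           q | equal        = d
  descend (p ◅ normal nf)   q | joined p′ _  = contradiction (_ , p′) nf
  descend (p ◅ d@(_ ◅ _))   q | joined p′ q′ = q′ ◅ descend d p′

  noInfiniteSequence : ∀ {k} (f : ℕ → A) → Normalizes k (f 0) → ¬ (∀ i → f i ⟶ f (suc i))
  noInfiniteSequence f (normal nf)  steps = nf (_ , steps 0)
  noInfiniteSequence f d@(_ ◅ _)    steps =
    noInfiniteSequence (f ∘ suc) (descend d (steps 0)) (steps ∘ suc)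

-- Entries are replaced one at a time from the front. `_∼_` is a parameter so that the induction can
-- instantiate it with the relation on tails below an already replaced head.
updates : (_≲_ : Rel A ℓ₁) (_∼_ : Rel (Vec A k) ℓ₂) →
          (∀ {xs} → xs ∼ xs) → (∀ {xs ys zs} → xs ∼ ys → ys ∼ zs → xs ∼ zs) →
          (∀ i {xs y} → lookup xs i ≲ y → xs ∼ (xs [ i ]≔ y)) →
          ∀ {xs ys} → (∀ i → lookup xs i ≲ lookup ys i) → xs ∼ ys
updates _≲_ _∼_ rfl trs upd {[]}     {[]}     rs = rfl
updates _≲_ _∼_ rfl trs upd {x ∷ xs} {y ∷ ys} rs =
  trs (upd zero (rs zero))
      (updates _≲_ (λ xs ys → (y ∷ xs) ∼ (y ∷ ys)) rfl trs (λ i → upd (suc i)) (rs ∘ suc))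

module _ {𝒪 : Signature} where

  private
    Tm : ℕ → Set
    Tm = Term 𝒪

    open module T = TermSubst (termSubst 𝒪) using (_/_; sub; _↑; weaken)

    variable
      b : Rule
      s : Surface b
      M M′ N N′ P P′ Q Q′ : Tm n
      σ τ : Sub Tm m n

  -- Substitution

  -- The generic theory asks that sequences of substitutions agreeing on variables under all
  -- liftings agree on terms; in return it yields `sub-commutes`, the substitution lemma behind
  -- `⟶-/`.
  termLemmas : TermLemmas Tm
  termLemmas = record
    { termSubst = termSubst 𝒪
    ; app-var   = refl
    ; /✶-↑✶     = Lemma./✶-↑✶
    }
    where
    module App {ℓ} {T : ℕ → Set ℓ} (l : Lift T Tm) where
      open Lift l hiding (var)
      open TermApp 𝒪 l renaming (_/_ to _⊘_)

      application : Application Tm T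
      application = record { _/_ = _⊘_ }

      open Application application using (_/✶_)

      ƛ-/✶-↑✶ : ∀ k {m n t} (ρs : Subs T m n) →
                ƛ t /✶ ρs ↑✶ k ≡ ƛ (t /✶ ρs ↑✶ suc k)
      ƛ-/✶-↑✶ k ε        = refl
      ƛ-/✶-↑✶ k (ρ ◅ ρs) = cong (_⊘ ρ ↑⋆ k) (ƛ-/✶-↑✶ k ρs)

      ·-/✶-↑✶ : ∀ k {m n t u} (ρs : Subs T m n) →
                (t · u) /✶ ρs ↑✶ k ≡ (t /✶ ρs ↑✶ k) · (u /✶ ρs ↑✶ k)
      ·-/✶-↑✶ k ε        = refl
      ·-/✶-↑✶ k (ρ ◅ ρs) = cong (_⊘ ρ ↑⋆ k) (·-/✶-↑✶ k ρs)

      /*-map : ∀ {l m n j} {f : Tm l → Tm m} (ts : Vec (Tm l) j) (ρ : Sub T m n) →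
               map f ts /* ρ ≡ map (λ t → f t ⊘ ρ) ts
      /*-map []       ρ = refl
      /*-map (t ∷ ts) ρ = cong (_ ∷_) (/*-map ts ρ)

      op-/✶-↑✶ : ∀ k {m n o ts} (ρs : Subs T m n) →
                 op o ts /✶ ρs ↑✶ k ≡ op o (map (_/✶ ρs ↑✶ k) ts)
      op-/✶-↑✶ k {ts = ts} ε        = cong (op _) (sym (map-id ts))
      op-/✶-↑✶ k {ts = ts} (ρ ◅ ρs) =
        trans (cong (_⊘ ρ ↑⋆ k) (op-/✶-↑✶ k ρs)) (cong (op _) (/*-map ts (ρ ↑⋆ k)))

    module Lemma {T₁ T₂ : ℕ → Set} {lift₁ : Lift T₁ Tm} {lift₂ : Lift T₂ Tm} where

      open T.Lifted lift₁ using () renaming (_↑✶_ to _↑✶₁_; _/✶_ to _/✶₁_)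
      open T.Lifted lift₂ using () renaming (_↑✶_ to _↑✶₂_; _/✶_ to _/✶₂_)
      open ≡-Reasoning

      /✶-↑✶ : ∀ {m n} (ρs₁ : Subs T₁ m n) (ρs₂ : Subs T₂ m n) →
              (∀ k x → var x /✶₁ ρs₁ ↑✶₁ k ≡ var x /✶₂ ρs₂ ↑✶₂ k) →
              ∀ k t → t /✶₁ ρs₁ ↑✶₁ k ≡ t /✶₂ ρs₂ ↑✶₂ k
      map-/✶-↑✶ : ∀ {m n} (ρs₁ : Subs T₁ m n) (ρs₂ : Subs T₂ m n) →
                  (∀ k x → var x /✶₁ ρs₁ ↑✶₁ k ≡ var x /✶₂ ρs₂ ↑✶₂ k) →
                  ∀ k {j} (ts : Vec (Tm (k + m)) j) →
                  map (_/✶₁ ρs₁ ↑✶₁ k) ts ≡ map (_/✶₂ ρs₂ ↑✶₂ k) ts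

      /✶-↑✶ ρs₁ ρs₂ hyp k (var x) = hyp k x
      /✶-↑✶ ρs₁ ρs₂ hyp k (ƛ t)   = begin
        ƛ t /✶₁ ρs₁ ↑✶₁ k        ≡⟨ App.ƛ-/✶-↑✶ _ k ρs₁ ⟩
        ƛ (t /✶₁ ρs₁ ↑✶₁ suc k)  ≡⟨ cong ƛ (/✶-↑✶ ρs₁ ρs₂ hyp (suc k) t) ⟩
        ƛ (t /✶₂ ρs₂ ↑✶₂ suc k)  ≡⟨ App.ƛ-/✶-↑✶ _ k ρs₂ ⟨
        ƛ t /✶₂ ρs₂ ↑✶₂ k        ∎
      /✶-↑✶ ρs₁ ρs₂ hyp k (t · u) = begin
        (t · u) /✶₁ ρs₁ ↑✶₁ k                  ≡⟨ App.·-/✶-↑✶ _ k ρs₁ ⟩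
        (t /✶₁ ρs₁ ↑✶₁ k) · (u /✶₁ ρs₁ ↑✶₁ k)  ≡⟨ cong₂ _·_ (/✶-↑✶ ρs₁ ρs₂ hyp k t)
                                                            (/✶-↑✶ ρs₁ ρs₂ hyp k u) ⟩
        (t /✶₂ ρs₂ ↑✶₂ k) · (u /✶₂ ρs₂ ↑✶₂ k)  ≡⟨ App.·-/✶-↑✶ _ k ρs₂ ⟨
        (t · u) /✶₂ ρs₂ ↑✶₂ k                  ∎
      /✶-↑✶ ρs₁ ρs₂ hyp k (op o ts) = begin
        op o ts /✶₁ ρs₁ ↑✶₁ k             ≡⟨ App.op-/✶-↑✶ _ k ρs₁ ⟩
        op o (map (_/✶₁ ρs₁ ↑✶₁ k) ts)    ≡⟨ cong (op o) (map-/✶-↑✶ ρs₁ ρs₂ hyp k ts) ⟩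
        op o (map (_/✶₂ ρs₂ ↑✶₂ k) ts)    ≡⟨ App.op-/✶-↑✶ _ k ρs₂ ⟨
        op o ts /✶₂ ρs₂ ↑✶₂ k             ∎

      map-/✶-↑✶ ρs₁ ρs₂ hyp k []       = refl
      map-/✶-↑✶ ρs₁ ρs₂ hyp k (t ∷ ts) =
        cong₂ _∷_ (/✶-↑✶ ρs₁ ρs₂ hyp k t) (map-/✶-↑✶ ρs₁ ρs₂ hyp k ts)

  open TermLemmas termLemmas using (sub-commutes; lookup-id; lookup-map-weaken; /-wk; lookup-wk)

  lookup-/* : (Ms : Vec (Tm m) k) (i : Fin k) →
              lookup (TermApp._/*_ 𝒪 T.termLift Ms σ) i ≡ lookup Ms i / σ
  lookup-/* (M ∷ Ms) zero    = refl
  lookup-/* (M ∷ Ms) (suc i) = lookup-/* Ms i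

  -- Surface reduction by structural rules

  Argument : Rule → Tm n → Set
  Argument β  _ = ⊤
  Argument βᵥ N = Value 𝒪 N

  -- Side conditions for the hole of a surface context to lie under ƛ, in the function position
  -- of an application with argument N, or in the argument position with function M.
  HoleƛOK : Surface b → Set
  HoleƛOK head  = ⊤
  HoleƛOK weak  = ⊥
  HoleƛOK left  = ⊥
  HoleƛOK right = ⊥

  HoleˡOK : Surface b → Tm n → Set
  HoleˡOK head  _ = ⊤
  HoleˡOK weak  _ = ⊤
  HoleˡOK left  _ = ⊤
  HoleˡOK right N = Value 𝒪 N

  HoleʳOK : Surface b → Tm n → Set
  HoleʳOK head  _ = ⊥
  HoleʳOK weak  _ = ⊤
  HoleʳOK left  M = Value 𝒪 M
  HoleʳOK right _ = ⊤

  infix 4 _⊢_⟶_ _⊢_⟶*_ _⊢_⇝_ _⊢_⇝*_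

  -- The same relation as `SurfaceReduction`, by `surface⁺` and `surface⁻`, but generated along the
  -- term constructors, so that peaks can be analysed by cases on the source.
  data _⊢_⟶_ {b} (s : Surface b) {n} : Rel (Tm n) 0ℓ where
    root : ∀ {M N} → Argument b N → s ⊢ ƛ M · N ⟶ M / sub N
    ƛ    : ∀ {M M′} → HoleƛOK s → s ⊢ M ⟶ M′ → s ⊢ ƛ M ⟶ ƛ M′
    appˡ : ∀ {M M′ N} → HoleˡOK s N → s ⊢ M ⟶ M′ → s ⊢ M · N ⟶ M′ · N
    appʳ : ∀ {M N N′} → HoleʳOK s M → s ⊢ N ⟶ N′ → s ⊢ M · N ⟶ M · N′

  _⊢_⟶*_ : Surface b → Rel (Tm n) 0ℓ
  s ⊢ M ⟶* N = Star (s ⊢_⟶_) M N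

  _⊢_⇝_ : Surface b → Rel (Tm n) 0ℓ
  s ⊢ M ⇝ N = Unbiased 𝒪 s M N

  _⊢_⇝*_ : Surface b → Rel (Tm n) 0ℓ
  s ⊢ M ⇝* N = Star (s ⊢_⇝_) M N

  Stuck : Surface b → Tm n → Set
  Stuck s = IsNormalForm (s ⊢_⟶_)

  root-↦ : {s : Surface b} → _⊢_↦_ 𝒪 b P Q → s ⊢ P ⟶ Q
  root-↦ contract      = root tt
  root-↦ (contractᵥ v) = root v

  ↦-root : ∀ b {M} {N : Tm n} → Argument b N → _⊢_↦_ 𝒪 b (ƛ M · N) (M / sub N)
  ↦-root β  _ = contract
  ↦-root βᵥ v = contractᵥ v

  □-surface : (s : Surface b) → IsSurface 𝒪 {k = n} s □
  □-surface head  = □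
  □-surface weak  = □
  □-surface left  = □
  □-surface right = □

  ƛ-surface : (s : Surface b) {C : Context 𝒪 k (suc n)} →
              HoleƛOK s → IsSurface 𝒪 s C → IsSurface 𝒪 s (ƛ C)
  ƛ-surface head _ = ƛ

  ·₁-surface : (s : Surface b) {C : Context 𝒪 k n} {N : Tm n} →
               HoleˡOK s N → IsSurface 𝒪 s C → IsSurface 𝒪 s (C ·₁ N)
  ·₁-surface head  _ c = c ·₁ _
  ·₁-surface weak  _ c = c ·₁ _
  ·₁-surface left  _ c = c ·₁ _
  ·₁-surface right v c = c ·₁ v

  ·₂-surface : (s : Surface b) {C : Context 𝒪 k n} {M : Tm n} →
               HoleʳOK s M → IsSurface 𝒪 s C → IsSurface 𝒪 s (M ·₂ C)
  ·₂-surface weak  _ c = _ ·₂ c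
  ·₂-surface left  v c = v ·₂ c
  ·₂-surface right _ c = _ ·₂ c

  surface⁺ : {s : Surface b} → s ⊢ M ⟶ M′ → SurfaceReduction 𝒪 s M M′
  surface⁺ {b = b} {s = s} (root v) = step {C = □} (□-surface s) (↦-root b v)
  surface⁺ {s = s} (ƛ h r) with surface⁺ r
  ... | step {C = C} c p = step {C = ƛ C} (ƛ-surface s h c) p
  surface⁺ {s = s} (appˡ {N = N} h r) with surface⁺ r
  ... | step {C = C} c p = step {C = C ·₁ N} (·₁-surface s h c) p
  surface⁺ {s = s} (appʳ {M = M} h r) with surface⁺ r
  ... | step {C = C} c p = step {C = M ·₂ C} (·₂-surface s h c) p

  plug-⟶ : (s : Surface b) {C : Context 𝒪 k n} → IsSurface 𝒪 s C → s ⊢ P ⟶ Q →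
           s ⊢ plug 𝒪 C P ⟶ plug 𝒪 C Q
  plug-⟶ head  □        r = r
  plug-⟶ head  (ƛ c)    r = ƛ tt (plug-⟶ head c r)
  plug-⟶ head  (c ·₁ _) r = appˡ tt (plug-⟶ head c r)
  plug-⟶ weak  □        r = r
  plug-⟶ weak  (c ·₁ _) r = appˡ tt (plug-⟶ weak c r)
  plug-⟶ weak  (_ ·₂ c) r = appʳ tt (plug-⟶ weak c r)
  plug-⟶ left  □        r = r
  plug-⟶ left  (c ·₁ _) r = appˡ tt (plug-⟶ left c r)
  plug-⟶ left  (v ·₂ c) r = appʳ v (plug-⟶ left c r)
  plug-⟶ right □        r = r
  plug-⟶ right (c ·₁ v) r = appˡ v (plug-⟶ right c r)
  plug-⟶ right (_ ·₂ c) r = appʳ tt (plug-⟶ right c r)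

  surface⁻ : SurfaceReduction 𝒪 s M M′ → s ⊢ M ⟶ M′
  surface⁻ {s = s} (step c p) = plug-⟶ s c (root-↦ p)

  stuck⁺ : Stuck s M → IsNormalForm (SurfaceReduction 𝒪 s) M
  stuck⁺ nf (_ , r) = nf (_ , surface⁻ r)

  stuck⁻ : IsNormalForm (SurfaceReduction 𝒪 s) M → Stuck s M
  stuck⁻ nf (_ , r) = nf (_ , surface⁺ r)

  -- Decidability of surface reducibility

  value? : (M : Tm n) → Dec (Value 𝒪 M)
  value? (var x)  = yes (var x)
  value? (ƛ M)    = yes (ƛ M)
  value? (M · N)  = no λ ()
  value? (op o _) = no λ ()

  argument? : ∀ b (N : Tm n) → Dec (Argument b N)
  argument? β  N = yes tt
  argument? βᵥ N = value? N

  holeƛ? : (s : Surface b) → Dec (HoleƛOK s)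
  holeƛ? head  = yes tt
  holeƛ? weak  = no λ ()
  holeƛ? left  = no λ ()
  holeƛ? right = no λ ()

  holeˡ? : (s : Surface b) (N : Tm n) → Dec (HoleˡOK s N)
  holeˡ? head  N = yes tt
  holeˡ? weak  N = yes tt
  holeˡ? left  N = yes tt
  holeˡ? right N = value? N

  holeʳ? : (s : Surface b) (M : Tm n) → Dec (HoleʳOK s M)
  holeʳ? head  M = no λ ()
  holeʳ? weak  M = yes tt
  holeʳ? left  M = value? M
  holeʳ? right M = yes tt

  data IsAbstraction {n} : Tm n → Set where
    ƛ : ∀ M → IsAbstraction (ƛ M)

  abstraction? : (M : Tm n) → Dec (IsAbstraction M)
  abstraction? (var x)  = no λ ()
  abstraction? (ƛ M)    = yes (ƛ M)
  abstraction? (M · N)  = no λ ()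
  abstraction? (op o _) = no λ ()

  -- Merging the reductions of subterms has to choose at each stage between a surface step and an
  -- inner step; constructively this takes a decision.
  step? : (s : Surface b) (M : Tm n) → Dec (∃ (s ⊢ M ⟶_))
  step? s (var x)  = no λ ()
  step? s (op o _) = no λ ()
  step? s (ƛ M) = map′ (λ { (h , _ , r) → _ , ƛ h r }) (λ { (_ , ƛ h r) → h , _ , r })
                       (holeƛ? s ×-dec step? s M)
  step? {b = b} s (M · N) =
    map′ (λ { (inj₁ (ƛ _ , v)) → _ , root v
            ; (inj₂ (inj₁ (h , _ , r))) → _ , appˡ h r
            ; (inj₂ (inj₂ (h , _ , r))) → _ , appʳ h r })
         (λ { (_ , root v)   → inj₁ (ƛ _ , v)
            ; (_ , appˡ h r) → inj₂ (inj₁ (h , _ , r))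
            ; (_ , appʳ h r) → inj₂ (inj₂ (h , _ , r)) })
         ((abstraction? M ×-dec argument? b N) ⊎-dec
          ((holeˡ? s N ×-dec step? s M) ⊎-dec (holeʳ? s M ×-dec step? s N)))

  -- Surface reduction is stable under substitution

  -- Variables are values, so under `βᵥ` a substitution preserves values, and with them redexes and
  -- hole conditions, when its images are values.
  Admissible : Rule → Sub Tm m n → Set
  Admissible b σ = ∀ x → Argument b (lookup σ x)

  value-/ : Admissible βᵥ σ → Value 𝒪 M → Value 𝒪 (M / σ)
  value-/ adm (var x) = adm x
  value-/ adm (ƛ M)   = ƛ _

  argument-/ : ∀ b → Admissible b σ → Argument b M → Argument b (M / σ)
  argument-/ β  adm v = tt
  argument-/ βᵥ adm v = value-/ adm v

  holeˡ-/ : (s : Surface b) → Admissible b σ → HoleˡOK s N → HoleˡOK s (N / σ)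
  holeˡ-/ head  adm h = tt
  holeˡ-/ weak  adm h = tt
  holeˡ-/ left  adm h = tt
  holeˡ-/ right adm h = value-/ adm h

  holeʳ-/ : (s : Surface b) → Admissible b σ → HoleʳOK s M → HoleʳOK s (M / σ)
  holeʳ-/ weak  adm h = tt
  holeʳ-/ left  adm h = value-/ adm h
  holeʳ-/ right adm h = tt

  argument-var : ∀ b {x : Fin n} → Argument b (var x)
  argument-var β  = tt
  argument-var βᵥ = var _

  argument-weaken : ∀ b {M : Tm n} → Argument b M → Argument b (weaken M)
  argument-weaken β  _       = tt
  argument-weaken βᵥ (var x) = var _
  argument-weaken βᵥ (ƛ M)   = ƛ _

  admissible-↑ : ∀ b {σ : Sub Tm m n} → Admissible b σ → Admissible b (σ ↑)
  admissible-↑ b {σ} adm zero    = argument-var b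
  admissible-↑ b {σ} adm (suc x) =
    subst (Argument b) (sym (lookup-map x weaken σ)) (argument-weaken b (adm x))

  admissible-sub : ∀ b {N : Tm n} → Argument b N → Admissible b (sub N)
  admissible-sub b v zero    = v
  admissible-sub b v (suc x) = subst (Argument b) (sym (lookup-id x)) (argument-var b)

  ⟶-/ : {s : Surface b} → Admissible b σ → s ⊢ M ⟶ M′ → s ⊢ M / σ ⟶ M′ / σ
  ⟶-/ {b = b} {σ = σ} {s = s} adm (root {M} {N} v) =
    subst (s ⊢ (ƛ M · N) / σ ⟶_) (sym (sub-commutes M)) (root (argument-/ b adm v))
  ⟶-/ {b = b} adm (ƛ h r)    = ƛ h (⟶-/ (admissible-↑ b adm) r)
  ⟶-/ {s = s} adm (appˡ h r) = appˡ (holeˡ-/ s adm h) (⟶-/ adm r)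
  ⟶-/ {s = s} adm (appʳ h r) = appʳ (holeʳ-/ s adm h) (⟶-/ adm r)

  -- Diamond properties

  -- Excludes a peak between a contraction and a step in the contracted argument, where steps could
  -- be duplicated or erased. Head contexts never enter an argument, and the contexts for `βᵥ` never
  -- enter an abstraction.
  argument-stuck : (s : Surface b) → HoleʳOK s M → Argument b N → Stuck s N
  argument-stuck weak  _ (ƛ _) (_ , ƛ () _)
  argument-stuck left  _ (ƛ _) (_ , ƛ () _)
  argument-stuck right _ (ƛ _) (_ , ƛ () _)

  value-⟶ : s ⊢ M ⟶ M′ → Value 𝒪 M → Value 𝒪 M′
  value-⟶ (ƛ _ _) _ = ƛ _

  holeˡ-⟶ : (s : Surface b) → s ⊢ N ⟶ N′ → HoleˡOK s N → HoleˡOK s N′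
  holeˡ-⟶ head  r h = tt
  holeˡ-⟶ weak  r h = tt
  holeˡ-⟶ left  r h = tt
  holeˡ-⟶ right r h = value-⟶ r h

  holeʳ-⟶ : (s : Surface b) → s ⊢ M ⟶ M′ → HoleʳOK s M → HoleʳOK s M′
  holeʳ-⟶ weak  r h = tt
  holeʳ-⟶ left  r h = value-⟶ r h
  holeʳ-⟶ right r h = tt

  surface-diamond : {s : Surface b} → s ⊢ M ⟶ N → s ⊢ M ⟶ P → Join (s ⊢_⟶_) N P
  surface-diamond (root _) (root _) = equal
  -- The function is an abstraction, so the step lies in its body and survives the substitution.
  surface-diamond {b = b} (root v) (appˡ _ (ƛ _ r)) =
    joined (⟶-/ (admissible-sub b v) r) (root v)
  surface-diamond {s = s} (root v) (appʳ h r) = ⊥-elim (argument-stuck s h v (_ , r))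
  surface-diamond {b = b} (appˡ _ (ƛ _ r)) (root v) =
    joined (root v) (⟶-/ (admissible-sub b v) r)
  surface-diamond {s = s} (appʳ h r) (root v) = ⊥-elim (argument-stuck s h v (_ , r))
  surface-diamond (ƛ h r) (ƛ _ q) = Join-map ƛ (λ _ → ƛ h) (surface-diamond r q)
  surface-diamond (appˡ h r) (appˡ _ q) = Join-map (_· _) (λ _ → appˡ h) (surface-diamond r q)
  surface-diamond (appʳ h r) (appʳ _ q) = Join-map (_ ·_) (λ _ → appʳ h) (surface-diamond r q)
  surface-diamond {s = s} (appˡ h r) (appʳ h′ q) =
    joined (appʳ (holeʳ-⟶ s r h′) q) (appˡ (holeˡ-⟶ s q h) r)
  surface-diamond {s = s} (appʳ h′ q) (appˡ h r) =
    joined (appˡ (holeˡ-⟶ s q h) r) (appʳ (holeʳ-⟶ s r h′) q)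

  -- Surface-normality under unbiased steps

  value-⇝ : s ⊢ M ⇝ M′ → Value 𝒪 M → Value 𝒪 M′
  value-⇝ (surface r) v = value-⟶ (surface⁻ r) v
  value-⇝ (ƛ _ _)     _ = ƛ _

  argument-⇝ : ∀ b {s : Surface b} → s ⊢ M ⇝ M′ → Argument b M → Argument b M′
  argument-⇝ β  r v = tt
  argument-⇝ βᵥ r v = value-⇝ r v

  -- An inner step keeps the outermost constructor, so only a surface step could turn a non-value
  -- into a value.
  value-reflect : s ⊢ M ⇝ M′ → Stuck s M → Value 𝒪 M′ → Value 𝒪 M
  value-reflect (surface r) nf _ = contradiction (_ , surface⁻ r) nf
  value-reflect (ƛ _ _)     nf _ = ƛ _

  -- Under `βᵥ`, the argument of an abstraction is open to surface steps in all three disciplines;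
  -- hence `Q` is itself stuck and `value-reflect` applies.
  argument-reflect : (s : Surface b) → Stuck s (ƛ P · Q) → s ⊢ Q ⇝ Q′ →
                     Argument b Q′ → Argument b Q
  argument-reflect head  nf r v = tt
  argument-reflect weak  nf r v = value-reflect r (λ (_ , q) → nf (_ , appʳ tt q)) v
  argument-reflect left  nf r v = value-reflect r (λ (_ , q) → nf (_ , appʳ (ƛ _) q)) v
  argument-reflect right nf r v = value-reflect r (λ (_ , q) → nf (_ , appʳ tt q)) v

  holeˡ-reflect : (s : Surface b) → Stuck s (P · Q) → s ⊢ Q ⇝ Q′ → HoleˡOK s Q′ → HoleˡOK s Q
  holeˡ-reflect head  nf r h = tt
  holeˡ-reflect weak  nf r h = tt
  holeˡ-reflect left  nf r h = tt
  holeˡ-reflect right nf r h = value-reflect r (λ (_ , q) → nf (_ , appʳ tt q)) h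

  holeʳ-reflect : (s : Surface b) → Stuck s (P · Q) → s ⊢ P ⇝ P′ → HoleʳOK s P′ → HoleʳOK s P
  holeʳ-reflect weak  nf r h = tt
  holeʳ-reflect left  nf r h = value-reflect r (λ (_ , q) → nf (_ , appˡ tt q)) h
  holeʳ-reflect right nf r h = tt

  -- In every discipline the function position is open once the argument can be contracted, so a
  -- surface step of the function is then one of the whole application.
  argument-holeˡ : (s : Surface b) → Argument b N → HoleˡOK s N
  argument-holeˡ head  v = tt
  argument-holeˡ weak  v = tt
  argument-holeˡ left  v = tt
  argument-holeˡ right v = v

  -- A surface step available after an inner step was already available before it, at the root or in
  -- the same subterm; the reflection lemmas carry the side conditions back.
  stuck-⇝ : {s : Surface b} → Stuck s M → s ⊢ M ⇝ M′ → Stuck s M′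
  stuck-⇝ nf (surface r) _ = nf (_ , surface⁻ r)
  stuck-⇝ nf (ƛ _ r) (_ , ƛ h q) = stuck-⇝ (λ (_ , p) → nf (_ , ƛ h p)) r (_ , q)
  -- Here the function may have become an abstraction only now, but the step that made it one is
  -- already a surface step of the application.
  stuck-⇝ {s = s} nf (appˡ _ (surface r)) (_ , root v) =
    nf (_ , appˡ (argument-holeˡ s v) (surface⁻ r))
  stuck-⇝ nf (appˡ _ (ƛ _ _)) (_ , root v) = nf (_ , root v)
  stuck-⇝ nf (appˡ _ r) (_ , appˡ h q) = stuck-⇝ (λ (_ , p) → nf (_ , appˡ h p)) r (_ , q)
  stuck-⇝ {s = s} nf (appˡ _ r) (_ , appʳ h q) = nf (_ , appʳ (holeʳ-reflect s nf r h) q)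
  stuck-⇝ {s = s} nf (appʳ _ r) (_ , root v) = nf (_ , root (argument-reflect s nf r v))
  stuck-⇝ {s = s} nf (appʳ _ r) (_ , appˡ h q) = nf (_ , appˡ (holeˡ-reflect s nf r h) q)
  stuck-⇝ nf (appʳ _ r) (_ , appʳ h q) = stuck-⇝ (λ (_ , p) → nf (_ , appʳ h p)) r (_ , q)
  stuck-⇝ nf (op _ _ _) (_ , ())

  surfaceNormal-⇝ : {s : Surface b} → IsNormalForm (SurfaceReduction 𝒪 s) M → s ⊢ M ⇝ M′ →
                    IsNormalForm (SurfaceReduction 𝒪 s) M′
  surfaceNormal-⇝ nf r = stuck⁺ (stuck-⇝ (stuck⁻ nf) r)

  surfaceNormal-op : ∀ {o} {Ps : Vec (Tm n) (Signature.arity 𝒪 o)} →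
              IsNormalForm (SurfaceReduction 𝒪 s) (op o Ps)
  surfaceNormal-op = stuck⁺ λ { (_ , ()) }

  -- The entry is overwritten on both sides so that successive steps in one argument compose.
  update-⇝ : ∀ o i {Ps : Vec (Tm n) (Signature.arity 𝒪 o)} → s ⊢ P ⇝ Q →
             s ⊢ op o (Ps [ i ]≔ P) ⇝ op o (Ps [ i ]≔ Q)
  update-⇝ {s = s} {P = P} {Q = Q} o i {Ps} r =
    subst (λ Qs → s ⊢ op o (Ps [ i ]≔ P) ⇝ op o Qs) ([]≔-idempotent Ps i)
      (op i surfaceNormal-op (subst (s ⊢_⇝ Q) (sym (lookup∘update i Ps P)) r))

  -- A surface step never meets an inner one, since inner rules require a surface-normal source. For
  -- two inner steps, `surfaceNormal-⇝` re-establishes this requirement at the reducts.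
  unbiased-diamond : s ⊢ M ⇝ N → s ⊢ M ⇝ P → Join (s ⊢_⇝_) N P
  unbiased-diamond (surface r) (surface q) =
    Join-map (λ M → M) (λ _ → surface ∘ surface⁺) (surface-diamond (surface⁻ r) (surface⁻ q))
  unbiased-diamond (surface r) (ƛ nf _)    = contradiction (_ , r) nf
  unbiased-diamond (surface r) (appˡ nf _) = contradiction (_ , r) nf
  unbiased-diamond (surface r) (appʳ nf _) = contradiction (_ , r) nf
  unbiased-diamond (surface r) (op _ nf _) = contradiction (_ , r) nf
  unbiased-diamond (ƛ nf _)    (surface r) = contradiction (_ , r) nf
  unbiased-diamond (appˡ nf _) (surface r) = contradiction (_ , r) nf
  unbiased-diamond (appʳ nf _) (surface r) = contradiction (_ , r) nf
  unbiased-diamond (op _ nf _) (surface r) = contradiction (_ , r) nf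
  unbiased-diamond (ƛ nf r) (ƛ _ q) =
    Join-map ƛ (λ { (inj₁ refl) → ƛ (surfaceNormal-⇝ nf (ƛ nf r))
                  ; (inj₂ refl) → ƛ (surfaceNormal-⇝ nf (ƛ nf q)) }) (unbiased-diamond r q)
  unbiased-diamond (appˡ nf r) (appˡ _ q) =
    Join-map (_· _) (λ { (inj₁ refl) → appˡ (surfaceNormal-⇝ nf (appˡ nf r))
                       ; (inj₂ refl) → appˡ (surfaceNormal-⇝ nf (appˡ nf q)) })
             (unbiased-diamond r q)
  unbiased-diamond (appʳ nf r) (appʳ _ q) =
    Join-map (_ ·_) (λ { (inj₁ refl) → appʳ (surfaceNormal-⇝ nf (appʳ nf r))
                       ; (inj₂ refl) → appʳ (surfaceNormal-⇝ nf (appʳ nf q)) })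
             (unbiased-diamond r q)
  unbiased-diamond (appˡ nf r) (appʳ _ q) =
    joined (appʳ (surfaceNormal-⇝ nf (appˡ nf r)) q)
           (appˡ (surfaceNormal-⇝ nf (appʳ nf q)) r)
  unbiased-diamond (appʳ nf q) (appˡ _ r) =
    joined (appˡ (surfaceNormal-⇝ nf (appʳ nf q)) r)
           (appʳ (surfaceNormal-⇝ nf (appˡ nf r)) q)
  unbiased-diamond {s = s} (op {o} {Ps} i {P} nf r) (op j {Q} _ q) with i ≟ j
  ... | yes refl =
    Join-map (λ R → op o (Ps [ i ]≔ R)) (λ _ → update-⇝ o i {Ps}) (unbiased-diamond r q)
  ... | no i≢j =
    joined
      (op j surfaceNormal-op (subst (s ⊢_⇝ Q) (sym (lookup∘update′ (i≢j ∘ sym) Ps P)) q))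
      (subst (λ Qs → s ⊢ op o (Ps [ j ]≔ Q) ⇝ op o Qs) ([]≔-commutes Ps j i (i≢j ∘ sym))
        (op i surfaceNormal-op (subst (s ⊢_⇝ P) (sym (lookup∘update′ i≢j Ps Q)) r)))

  -- Full reduction

  -- The equation keeps `P` a variable, so that matching on `step` can expose the context; unifying
  -- `plug C P` with a `lookup` would be stuck.
  update-Reduction : ∀ {o i} {Ps : Vec (Tm n) (Signature.arity 𝒪 o)} →
                     Reduction 𝒪 b P Q → lookup Ps i ≡ P →
                     Reduction 𝒪 b (op o Ps) (op o (Ps [ i ]≔ Q))
  update-Reduction {b = b} {o = o} {i} {Ps} (step C r) eq =
    subst (λ Qs → Reduction 𝒪 b (op o Qs) _)
      (trans (cong (Ps [ i ]≔_) (sym eq)) ([]≔-lookup Ps i)) (step (op o i Ps C) r)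

  Unbiased⇒Reduction : {s : Surface b} → s ⊢ M ⇝ M′ → Reduction 𝒪 b M M′
  Unbiased⇒Reduction (surface (step {C = C} _ r)) = step C r
  Unbiased⇒Reduction (ƛ _ r) with Unbiased⇒Reduction r
  ... | step C p = step (ƛ C) p
  Unbiased⇒Reduction (appˡ _ r) with Unbiased⇒Reduction r
  ... | step C p = step (C ·₁ _) p
  Unbiased⇒Reduction (appʳ _ r) with Unbiased⇒Reduction r
  ... | step C p = step (_ ·₂ C) p
  Unbiased⇒Reduction (op i _ r) = update-Reduction (Unbiased⇒Reduction r) refl

  -- The negative form helps the induction: a `⇝`-normal term is surface-normal, so any step of the
  -- subterm around the hole lifts by an inner rule and contradicts normality.
  redex-⇝-reducible : (s : Surface b) (C : Context 𝒪 k n) → _⊢_↦_ 𝒪 b P Q →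
                      ¬ IsNormalForm (s ⊢_⇝_) (plug 𝒪 C P)
  redex-⇝-reducible s □ r nf = nf (_ , surface (step (□-surface s) r))
  redex-⇝-reducible s (C ·₁ M) r nf =
    redex-⇝-reducible s C r λ (_ , q) → nf (_ , appˡ (λ (_ , p) → nf (_ , surface p)) q)
  redex-⇝-reducible s (M ·₂ C) r nf =
    redex-⇝-reducible s C r λ (_ , q) → nf (_ , appʳ (λ (_ , p) → nf (_ , surface p)) q)
  redex-⇝-reducible s (ƛ C) r nf =
    redex-⇝-reducible s C r λ (_ , q) → nf (_ , ƛ (λ (_ , p) → nf (_ , surface p)) q)
  redex-⇝-reducible s (op o i Ms C) r nf =
    redex-⇝-reducible s C r λ (_ , q) →
      nf (_ , op i surfaceNormal-op (subst (s ⊢_⇝ _) (sym (lookup∘update i Ms _)) q))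

  ⇝-normal⇒normal : (s : Surface b) → IsNormalForm (s ⊢_⇝_) M → IsNormalForm (Reduction 𝒪 b) M
  ⇝-normal⇒normal s nf (_ , step C r) = redex-⇝-reducible s C r nf

  -- Standardization

  -- After the surface phase the subterms reduce independently, with no order fixed among them;
  -- `app-⇝*` and `op-⇝*` choose one later.
  data Standard {b} (s : Surface b) {n} (M : Tm n) : Tm n → Set where
    var : ∀ {x} → s ⊢ M ⟶* var x → Standard s M (var x)
    ƛ   : ∀ {P P′} → s ⊢ M ⟶* ƛ P → Standard s P P′ → Standard s M (ƛ P′)
    app : ∀ {P P′ Q Q′} → s ⊢ M ⟶* P · Q → Standard s P P′ → Standard s Q Q′ →
          Standard s M (P′ · Q′)
    op  : ∀ {o Ps Ps′} → s ⊢ M ⟶* op o Ps →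
          (∀ i → Standard s (lookup Ps i) (lookup Ps′ i)) → Standard s M (op o Ps′)

  standard-prepend : s ⊢ M ⟶* M′ → Standard s M′ N → Standard s M N
  standard-prepend rs (var qs)     = var (rs ◅◅ qs)
  standard-prepend rs (ƛ qs d)     = ƛ (rs ◅◅ qs) d
  standard-prepend rs (app qs d e) = app (rs ◅◅ qs) d e
  standard-prepend rs (op qs ds)   = op (rs ◅◅ qs) ds

  mutual
    standard-refl : (M : Tm n) → Standard s M M
    standard-refl (var x)   = var ε
    standard-refl (ƛ M)     = ƛ ε (standard-refl M)
    standard-refl (M · N)   = app ε (standard-refl M) (standard-refl N)
    standard-refl (op o Ms) = op ε (standard-refl* Ms)

    standard-refl* : (Ms : Vec (Tm n) k) (i : Fin k) → Standard s (lookup Ms i) (lookup Ms i)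
    standard-refl* (M ∷ Ms) zero    = standard-refl M
    standard-refl* (M ∷ Ms) (suc i) = standard-refl* Ms i

  -- The relation between substitutions is abstract because weakening, needed to lift a pair
  -- of standardly related substitutions, is itself an instance (of renamings).
  module Substitutive {b} {s : Surface b} (_≈_ : ∀ {m n} → Rel (Sub Tm m n) 0ℓ)
    (lift       : ∀ {m n} {σ τ : Sub Tm m n} → σ ≈ τ → (σ ↑) ≈ (τ ↑))
    (admissible : ∀ {m n} {σ τ : Sub Tm m n} → σ ≈ τ → Admissible b σ)
    (pointwise  : ∀ {m n} {σ τ : Sub Tm m n} → σ ≈ τ → ∀ x → Standard s (lookup σ x) (lookup τ x))
    where

    ⟶*-/ : {σ τ : Sub Tm m n} → σ ≈ τ → s ⊢ M ⟶* M′ → s ⊢ M / σ ⟶* M′ / σ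
    ⟶*-/ σ≈τ = gmap (_/ _) (⟶-/ (admissible σ≈τ))

    standard-/ : {σ τ : Sub Tm m n} → σ ≈ τ → Standard s M M′ → Standard s (M / σ) (M′ / τ)
    standard-/ σ≈τ (var rs)     = standard-prepend (⟶*-/ σ≈τ rs) (pointwise σ≈τ _)
    standard-/ σ≈τ (ƛ rs d)     = ƛ (⟶*-/ σ≈τ rs) (standard-/ (lift σ≈τ) d)
    standard-/ σ≈τ (app rs d e) = app (⟶*-/ σ≈τ rs) (standard-/ σ≈τ d) (standard-/ σ≈τ e)
    standard-/ {σ = σ} {τ} σ≈τ (op {Ps = Ps} {Ps′} rs ds) = op (⟶*-/ σ≈τ rs) λ i →
      subst (Standard s _) (sym (lookup-/* Ps′ i))
        (subst (λ P → Standard s P _) (sym (lookup-/* Ps i)) (standard-/ σ≈τ (ds i)))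

  -- A diagonal relation: its pointwise condition is reflexivity and its lifting needs no weakening
  -- of standard reductions, which avoids circularity in `standard-weaken`.
  data Renaming {m n} (σ : Sub Tm m n) : Sub Tm m n → Set where
    renames : (∀ x → ∃ λ y → lookup σ x ≡ var y) → Renaming σ σ

  renaming-↑ : Renaming σ τ → Renaming (σ ↑) (τ ↑)
  renaming-↑ {σ = σ} (renames f) = renames λ where
    zero    → zero , refl
    (suc x) → let y , σx≡y = f x in suc y , lookup-map-weaken x {ρ = σ} σx≡y

  renaming-admissible : ∀ b {σ τ : Sub Tm m n} → Renaming σ τ → Admissible b σ
  renaming-admissible b (renames f) x =
    let _ , σx≡y = f x in subst (Argument b) (sym σx≡y) (argument-var b)

  renaming-standard : Renaming σ τ → ∀ x → Standard s (lookup σ x) (lookup τ x)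
  renaming-standard (renames _) x = standard-refl _

  standard-weaken : {s : Surface b} → Standard s M M′ → Standard s (weaken M) (weaken M′)
  standard-weaken {b = b} {M = M} {M′} {s} d =
    subst (λ P → Standard s P (weaken M′)) (/-wk {t = M})
      (subst (Standard s (M / T.wk)) (/-wk {t = M′})
        (standard-/ (renames λ x → suc x , lookup-wk x) d))
    where open Substitutive Renaming renaming-↑ (renaming-admissible b) renaming-standard

  -- Admissibility concerns only `σ`, because surface steps are substituted into only on the source
  -- side.
  StandardSub : Surface b → Rel (Sub Tm m n) 0ℓ
  StandardSub {b} s σ τ = Admissible b σ × (∀ x → Standard s (lookup σ x) (lookup τ x))

  standardSub-↑ : {s : Surface b} → StandardSub s σ τ → StandardSub s (σ ↑) (τ ↑)
  standardSub-↑ {b = b} {σ = σ} {τ} {s} (adm , ds) = admissible-↑ b adm , λ where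
    zero    → standard-refl _
    (suc x) → subst (Standard s _) (sym (lookup-map x weaken τ))
                (subst (λ P → Standard s P _) (sym (lookup-map x weaken σ))
                  (standard-weaken (ds x)))

  standard-sub : {s : Surface b} → Argument b N → Standard s P P′ → Standard s N N′ →
                 Standard s (P / sub N) (P′ / sub N′)
  standard-sub {b = b} {s = s} v d e =
    standard-/ (admissible-sub b v , λ { zero → e ; (suc x) → standard-refl _ }) d
    where open Substitutive (StandardSub s) standardSub-↑ proj₁ proj₂

  -- The surface phase already exposes the outermost constructor of `N`, and that constructor alone
  -- makes a term a value.
  standard-value : Standard s M N → Value 𝒪 N →
                   ∃ λ V → s ⊢ M ⟶* V × Value 𝒪 V × Standard s V N
  standard-value (var rs) (var x)  = _ , rs , var x , var ε
  standard-value (ƛ rs d) (ƛ _)    = _ , rs , ƛ _ , ƛ ε d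

  -- The discipline dictates the order: `left` needs the function to be a value before the argument
  -- moves, `right` the reverse, `weak` allows either, and `head` leaves the argument alone.
  contract-⟶* : (s : Surface b) → s ⊢ M ⟶* ƛ P → Argument b N′ → Standard s N N′ →
                ∃ λ V → s ⊢ M · N ⟶* ƛ P · V × Argument b V × Standard s V N′
  contract-⟶* {N = N} head ms _ d = N , gmap (_· N) (appˡ tt) ms , tt , d
  contract-⟶* {N = N} weak ms v d with standard-value d v
  ... | V , ns , w , e = V , gmap (_· N) (appˡ tt) ms ◅◅ gmap (_ ·_) (appʳ tt) ns , w , e
  contract-⟶* {N = N} left ms v d with standard-value d v
  ... | V , ns , w , e = V , gmap (_· N) (appˡ tt) ms ◅◅ gmap (_ ·_) (appʳ (ƛ _)) ns , w , e
  contract-⟶* {M = M} right ms v d with standard-value d v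
  ... | V , ns , w , e = V , gmap (M ·_) (appʳ tt) ns ◅◅ gmap (_· V) (appˡ w) ms , w , e

  -- The surface phases of `M` and of both components reach a redex that may be contracted by a
  -- surface step; what remains is standard by `standard-sub`.
  standard-root : {s : Surface b} → Argument b Q → Standard s M (ƛ P · Q) →
                  Standard s M (P / sub Q)
  standard-root {s = s} v (app rs (ƛ ps d) e) with contract-⟶* s ps v e
  ... | V , qs , w , e′ = standard-prepend (rs ◅◅ qs ◅◅ root w ◅ ε) (standard-sub w d e′)

  -- A standard reduction mirrors the shape of its final term, so one can follow `C` down to the
  -- redex and use `standard-root` there.
  standard-plug : {s : Surface b} (C : Context 𝒪 k n) → _⊢_↦_ 𝒪 b P Q →
                  Standard s M (plug 𝒪 C P) → Standard s M (plug 𝒪 C Q)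
  standard-plug □        contract      d            = standard-root tt d
  standard-plug □        (contractᵥ v) d            = standard-root v d
  standard-plug (C ·₁ N) r             (app rs d e) = app rs (standard-plug C r d) e
  standard-plug (N ·₂ C) r             (app rs d e) = app rs d (standard-plug C r e)
  standard-plug (ƛ C)    r             (ƛ rs d)     = ƛ rs (standard-plug C r d)
  standard-plug {P = P} {Q} {s = s} (op o i Ms C) r (op {Ps = Ps} rs ds) = op rs ds′
    where
    ds′ : ∀ j → Standard s (lookup Ps j) (lookup (Ms [ i ]≔ plug 𝒪 C Q) j)
    ds′ j with i ≟ j
    ... | yes refl = subst (Standard s _) (sym (lookup∘update i Ms _))
                       (standard-plug C r (subst (Standard s _) (lookup∘update i Ms _) (ds i)))
    ... | no i≢j = subst (Standard s _)
                     (trans (lookup∘update′ (i≢j ∘ sym) Ms _)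
                            (sym (lookup∘update′ (i≢j ∘ sym) Ms _))) (ds j)

  standardization : {s : Surface b} → Star (Reduction 𝒪 b) M N → Standard s M N
  standardization rs = go rs (standard-refl _)
    where
    go : {s : Surface b} → Star (Reduction 𝒪 b) M N → Standard s P M → Standard s P N
    go ε               d = d
    go (step C r ◅ rs) d = go rs (standard-plug C r d)

  -- Unbiased reduction reaches the normal form

  Normal : Rule → Tm n → Set
  Normal b = IsNormalForm (Reduction 𝒪 b)

  normal-stuck : {s : Surface b} → Normal b M → Stuck s M
  normal-stuck nf (_ , r) = nf (_ , Unbiased⇒Reduction (surface (surface⁺ r)))

  normal-ƛ : Normal b (ƛ M) → Normal b M
  normal-ƛ nf (_ , step C r) = nf (_ , step (ƛ C) r)

  normal-·₁ : Normal b (M · N) → Normal b M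
  normal-·₁ nf (_ , step C r) = nf (_ , step (C ·₁ _) r)

  normal-·₂ : Normal b (M · N) → Normal b N
  normal-·₂ nf (_ , step C r) = nf (_ , step (_ ·₂ C) r)

  normal-lookup : ∀ {o} {Ms : Vec (Tm n) (Signature.arity 𝒪 o)} →
                  Normal b (op o Ms) → ∀ i → Normal b (lookup Ms i)
  normal-lookup nf i (_ , r) = nf (_ , update-Reduction r refl)

  argument-⇝* : {s : Surface b} → s ⊢ M ⇝* N → Argument b M → Argument b N
  argument-⇝*         ε        v = v
  argument-⇝* {b = b} (r ◅ rs) v = argument-⇝* rs (argument-⇝ b r v)

  ƛ-⇝* : s ⊢ ƛ M ⇝* N → IsAbstraction N
  ƛ-⇝* ε = ƛ _
  ƛ-⇝* (surface r ◅ rs) with surface⁻ r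
  ... | ƛ _ _ = ƛ-⇝* rs
  ƛ-⇝* (ƛ _ _ ◅ rs) = ƛ-⇝* rs

  -- Lets the next step of a subterm's given sequence serve as a surface step of the whole term.
  first-surface : s ⊢ M ⟶ M′ → s ⊢ M ⇝ N → s ⊢ M ⟶ N
  first-surface r (surface q) = surface⁻ q
  first-surface r (ƛ nf _)    = contradiction (_ , surface⁺ r) nf
  first-surface r (appˡ nf _) = contradiction (_ , surface⁺ r) nf
  first-surface r (appʳ nf _) = contradiction (_ , surface⁺ r) nf
  first-surface r (op _ nf _) = contradiction (_ , surface⁺ r) nf

  -- Merges the two sequences, consuming one step of either at each stage. A stuck application takes
  -- function steps first; otherwise its surface step says which sequence must advance.
  app-⇝* : (s : Surface b) → s ⊢ P ⇝* P′ → s ⊢ Q ⇝* Q′ → Normal b (P′ · Q′) →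
           s ⊢ P · Q ⇝* P′ · Q′
  app-⇝* {P = P} {Q = Q} s ps qs nf with step? s (P · Q)
  app-⇝* s ε        ε        nf | no stuck = ε
  app-⇝* s (p ◅ ps) qs       nf | no stuck = appˡ (stuck⁺ stuck) p ◅ app-⇝* s ps qs nf
  app-⇝* s ε        (q ◅ qs) nf | no stuck = appʳ (stuck⁺ stuck) q ◅ app-⇝* s ε qs nf
  -- A root redex would persist along both sequences, as abstractions and admissible arguments are
  -- preserved, and so contradict normality of the result.
  app-⇝* s ps       qs       nf | yes (_ , root v) with ƛ-⇝* ps
  ... | ƛ _ = contradiction (_ , root (argument-⇝* qs v)) (normal-stuck {s = s} nf)
  -- The exhausted side is normal, so the surface step cannot lie there.
  app-⇝* s ε        qs       nf | yes (_ , appˡ h r) =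
    contradiction (_ , r) (normal-stuck (normal-·₁ nf))
  app-⇝* s (p ◅ ps) qs       nf | yes (_ , appˡ h r) =
    surface (surface⁺ (appˡ h (first-surface r p))) ◅ app-⇝* s ps qs nf
  app-⇝* s ps       ε        nf | yes (_ , appʳ h r) =
    contradiction (_ , r) (normal-stuck (normal-·₂ nf))
  app-⇝* s ps       (q ◅ qs) nf | yes (_ , appʳ h r) =
    surface (surface⁺ (appʳ h (first-surface r q))) ◅ app-⇝* s ps qs nf

  ƛ-step : (s : Surface b) → s ⊢ P ⇝ Q → s ⊢ ƛ P ⇝ ƛ Q
  ƛ-step s p with step? s (ƛ _)
  ... | no stuck        = ƛ (stuck⁺ stuck) p
  ... | yes (_ , ƛ h r) = surface (surface⁺ (ƛ h (first-surface r p)))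

  update-lookup-⇝* : ∀ o i {Ps : Vec (Tm n) (Signature.arity 𝒪 o)} → s ⊢ lookup Ps i ⇝* Q →
                     s ⊢ op o Ps ⇝* op o (Ps [ i ]≔ Q)
  update-lookup-⇝* {s = s} {Q = Q} o i {Ps} rs =
    subst (λ Qs → s ⊢ op o Qs ⇝* op o (Ps [ i ]≔ Q)) ([]≔-lookup Ps i)
      (gmap {U = s ⊢_⇝_} (λ P → op o (Ps [ i ]≔ P)) (update-⇝ o i {Ps}) rs)

  -- Operator terms are always surface-normal, so the arguments can be reduced one after another
  -- without merging.
  op-⇝* : ∀ {o} {Ps Qs : Vec (Tm n) (Signature.arity 𝒪 o)} →
          (∀ i → s ⊢ lookup Ps i ⇝* lookup Qs i) → s ⊢ op o Ps ⇝* op o Qs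
  op-⇝* {s = s} {o} rs =
    updates (s ⊢_⇝*_) (λ Ps Qs → s ⊢ op o Ps ⇝* op o Qs) ε _◅◅_ (λ i → update-lookup-⇝* o i) rs

  standard-normal : {s : Surface b} → Standard s M N → Normal b N → s ⊢ M ⇝* N
  standard-normal {s = s} d nf = go d nf
    where
    ⟶*⇒⇝* : s ⊢ M ⟶* N → s ⊢ M ⇝* N
    ⟶*⇒⇝* = Star.map (surface ∘ surface⁺)

    go : Standard s M N → Normal _ N → s ⊢ M ⇝* N
    go (var rs)     nf = ⟶*⇒⇝* rs
    go (ƛ rs d)     nf = ⟶*⇒⇝* rs ◅◅ gmap ƛ (ƛ-step s) (go d (normal-ƛ nf))
    go (app rs d e) nf =
      ⟶*⇒⇝* rs ◅◅ app-⇝* s (go d (normal-·₁ nf)) (go e (normal-·₂ nf)) nf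
    go (op rs ds)   nf = ⟶*⇒⇝* rs ◅◅ op-⇝* λ i → go (ds i) (normal-lookup nf i)

mainTheorem5 : (𝒪 : Signature) (b : Rule) (s : Surface b) (n : ℕ) →
    IsNormalizingStrategy {A = Term 𝒪 n} (Reduction 𝒪 b) (Unbiased 𝒪 s)
mainTheorem5 𝒪 b s n = record
  { subrelation     = Unbiased⇒Reduction
  ; sameNormalForms = λ t → mk⇔ (⇝-normal⇒normal s)
                                (λ nf (_ , r) → nf (_ , Unbiased⇒Reduction r))
  ; normalizing     = ends-in-normal
  }
  where
  open RandomDescent {A = Term 𝒪 n} {Unbiased 𝒪 s} unbiased-diamond

  ends-in-normal : ∀ t → HasNormalForm (Reduction 𝒪 b) t →
                   (ρ : MaximalSequence (Unbiased 𝒪 s) t) →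
                   EndsIn (IsNormalForm (Reduction 𝒪 b)) ρ
  ends-in-normal t _              (finite rs nf)        = ends (⇝-normal⇒normal s nf)
  -- Standardization gives one finite sequence to `u`, and its length bounds every sequence from
  -- `t`.
  ends-in-normal t (u , nf , rs) (infinite f refl steps) =
    let _ , d = fromStar (standard-normal (standardization rs) nf)
                         (λ (_ , r) → nf (_ , Unbiased⇒Reduction r))
    in ⊥-elim (noInfiniteSequence f d steps)
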